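{- Let $n\ge4$, $i\in[n-2]$ and $m=n-i-1$. Then $$\sum_{k=1}^{i}\frac{q_{n-k,m}}{2}\,(r_{n-k,m}+i-k+1)\, d_{k,n}\,(i-k)! \;=\; \frac{q_{n,m}}{2}\,(r_{n,m}+i+1)\, i!,$$ where $d_{k,n}=|\mathcal D_{k,n}|$.
   Context: $[n]=\{1,\ldots,n\}$. For integers $l$ and $m\ne0$, $q_{l,m}$ and $r_{l,m}$ are the quotient and remainder of $l$ divided by $m$ ($l=q_{l,m}m+r_{l,m}$, $0\le r_{l,m}<m$). A finite set $A\subset\mathbb P$ with $|A|\ge2$ is periodic if the differences between consecutive elements (in increasing order) are all equal. For $n\ge3$, $k\in[n-2]$, $\mathcal D_{k,n}$ is the set of words $u=u_1\cdots u_k$ of $k$ distinct letters of $[n]$ such that $[n]\setminus\{u_1,\ldots,u_k\}$ is periodic and for every $j<k$ the set $[n]\setminus\{u_1,\ldots,u_j\}$ is not periodic. -}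

module Defs where

open import Algebra.Properties.CommutativeMonoid.Sum using ()
open import Data.Fin.Base as Fin using (Fin; toℕ)
open import Data.Fin.Properties using (all?; _≟_; _<?_)
open import Data.Fin.Subset using (Subset; _∈_; _∉_; ∣_∣; ∁; ⁅_⁆; ⋃)
open import Data.Fin.Subset.Properties using (_∈?_)
open import Data.Integer.Base using (+_)
open import Data.List.Base as List using (List; []; _∷_; allFin; cartesianProductWith; filter; length; take)
open import Data.List.Membership.Propositional as List∈ using ()
open import Data.List.Membership.Propositional.Properties using (∈-allFin; ∈-cartesianProductWith⁺)
open import Data.List.Relation.Unary.All as All using ()
open import Data.List.Relation.Unary.AllPairs as AllPairs using ()
open import Data.List.Relation.Unary.Any using (here)
open import Data.List.Relation.Unary.Unique.Propositional using (Unique)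
open import Data.List.Relation.Unary.Unique.Propositional.Properties using (allFin⁺; cartesianProductWith⁺)
open import Data.Nat.Base using (ℕ; zero; suc; _∸_; _≤_; _<_; s≤s; NonZero)
open import Data.Nat.Properties as ℕ using (_≤?_; allUpTo?)
open import Data.Product.Base using (_×_)
open import Data.Rational.Base using (ℚ; _/_)
open import Data.Rational.Properties using (+-0-commutativeMonoid)
open import Data.Vec.Base as Vec using (Vec; toList)
open import Data.Vec.Properties using (∷-injective)
open import Relation.Binary.PropositionalEquality using (_≡_; refl)
open import Relation.Nullary.Decidable using (Dec; ¬?; _×-dec_; _→-dec_)
open import Relation.Nullary.Negation using (¬_)

open Algebra.Properties.CommutativeMonoid.Sum +-0-commutativeMonoid public
  using (sum-syntax)

-- Throughout, x : Fin n stands for the letter toℕ x + 1 of [n] = {1, …, n};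
-- differences of letters, hence periodicity, do not depend on this shift.

Consecutive : ∀ {n} → Subset n → Fin n → Fin n → Set
Consecutive A x y =
  x ∈ A × y ∈ A × x Fin.< y × (∀ z → x Fin.< z → z Fin.< y → z ∉ A)

Periodic : ∀ {n} → Subset n → Set
Periodic A = 2 ≤ ∣ A ∣ ×
  (∀ x y x′ y′ → Consecutive A x y → Consecutive A x′ y′ →
     toℕ y ∸ toℕ x ≡ toℕ y′ ∸ toℕ x′)

-- [n] ∖ {u₁, …, uⱼ}
remaining : ∀ {n k} → ℕ → Vec (Fin n) k → Subset n
remaining j u = ∁ (⋃ (List.map ⁅_⁆ (take j (toList u))))

-- The index j starts at 1: since [n] itself is periodic for n ≥ 2, allowing
-- the empty prefix would make every 𝒟ₖ,ₙ empty.
𝒟 : ∀ {n k} → Vec (Fin n) k → Set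
𝒟 {k = k} u = Unique (toList u) × Periodic (remaining k u) ×
  (∀ {j} → j < k → 1 ≤ j → ¬ Periodic (remaining j u))

consecutive? : ∀ {n} (A : Subset n) x y → Dec (Consecutive A x y)
consecutive? A x y =
  (x ∈? A) ×-dec (y ∈? A) ×-dec (x <? y) ×-dec
  all? (λ z → (x <? z) →-dec (z <? y) →-dec ¬? (z ∈? A))

periodic? : ∀ {n} (A : Subset n) → Dec (Periodic A)
periodic? A = (2 ≤? ∣ A ∣) ×-dec
  all? λ x → all? λ y → all? λ x′ → all? λ y′ →
    consecutive? A x y →-dec consecutive? A x′ y′ →-dec
    (toℕ y ∸ toℕ x ℕ.≟ toℕ y′ ∸ toℕ x′)

𝒟? : ∀ {n k} (u : Vec (Fin n) k) → Dec (𝒟 u)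
𝒟? {k = k} u =
  AllPairs.allPairs? (λ x y → ¬? (x ≟ y)) (toList u) ×-dec
  periodic? (remaining k u) ×-dec
  allUpTo? (λ j → (1 ≤? j) →-dec ¬? (periodic? (remaining j u))) k

words : ∀ k n → List (Vec (Fin n) k)
words zero    n = Vec.[] ∷ []
words (suc k) n = cartesianProductWith Vec._∷_ (allFin n) (words k n)

-- The next two facts justify counting 𝒟ₖ,ₙ along the list words k n.
words-complete : ∀ {k n} (u : Vec (Fin n) k) → u List∈.∈ words k n
words-complete Vec.[]      = here refl
words-complete (x Vec.∷ u) =
  ∈-cartesianProductWith⁺ Vec._∷_ (∈-allFin x) (words-complete u)

words-unique : ∀ k n → Unique (words k n)
words-unique zero    n = All.[] AllPairs.∷ AllPairs.[]
words-unique (suc k) n =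
  cartesianProductWith⁺ Vec._∷_ ∷-injective (allFin⁺ n) (words-unique k n)

d : ℕ → ℕ → ℕ
d k n = length (filter 𝒟? (words k n))

fromℕ : ℕ → ℚ
fromℕ a = + a / 1

m-nonZero : ∀ {n i} → 4 ≤ n → i ≤ n ∸ 2 → NonZero (n ∸ i ∸ 1)
m-nonZero {suc (suc n)} {i} (s≤s (s≤s _)) i≤n
  rewrite ℕ.+-∸-assoc 2 i≤n = _

{-# OPTIONS --safe #-}

-- Both sides count the words of i distinct letters of [n] whose complement,
-- of size m + 1, is periodic.
-- A periodic set of size l is an arithmetic progression, so it has as many
-- (m + 1)-term progressions as an interval of length l; listing those by their
-- last term gives Σ_{x < l} ⌊x / m⌋ = q (l + r - m) / 2, where l = q m + r.
-- By double counting, every such progression is the complement of exactly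
-- (l - m - 1)! words in the l letters.  For l = n this is the right-hand side.
-- On the left, a word is cut after the first k ≥ 1 letters whose complement is
-- periodic: its beginning lies in 𝒟ₖ,ₙ, and the rest is a word over the
-- n - k remaining letters, again a periodic set.
module Submission where

open import Data.Bool.Base using (true; false; if_then_else_)
open import Data.Fin.Base as Fin using (Fin; toℕ; fromℕ<)
import Data.Fin.Properties as Fin
open import Data.Fin.Subset as Subset using (Subset; ∁; ⁅_⁆; ⋃)
import Data.Fin.Subset.Properties as Subset
open import Data.List.Base using
  (List; []; _∷_; _++_; _∷ʳ_; map; filter; length; allFin; upTo; applyUpTo; take
  ; cartesianProductWith)
open import Data.List.Properties using
  (length-map; length-++; length-applyUpTo; length-upTo; length-tabulate; map-applyUpTo
  ; filter-none; filter-++; ∷ʳ-++; ++-identityʳ; take-all; map-∘)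
open import Data.List.Membership.Propositional using (_∈_; _∉_)
open import Data.List.Membership.Propositional.Properties
open import Data.List.Membership.Propositional.Properties.WithK using (unique∧set⇒bag)
import Data.List.Membership.DecPropositional as DecMembership
open import Data.List.Relation.Binary.BagAndSetEquality using (∼bag⇒↭)
open import Data.List.Relation.Binary.Permutation.Propositional.Properties using (↭-length)
open import Data.List.Relation.Binary.Disjoint.Propositional using (Disjoint)
open import Data.List.Relation.Unary.All as All using (All; []; _∷_)
import Data.List.Relation.Unary.All.Properties as All
open import Data.List.Relation.Unary.AllPairs as AllPairs using (AllPairs; []; _∷_)
import Data.List.Relation.Unary.AllPairs.Properties as AllPairs
open import Data.List.Relation.Unary.Any using (here; there)
open import Data.List.Relation.Unary.Linked as Linked using (Linked; []; [-]; _∷_)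
import Data.List.Relation.Unary.Linked.Properties as Linked
open import Data.List.Relation.Unary.Unique.Propositional using (Unique)
open import Data.List.Relation.Unary.Unique.Propositional.Properties as Unique using
  (allFin⁺; upTo⁺; applyUpTo⁺₁)
open import Data.Nat.Base as ℕ using
  (ℕ; zero; suc; _+_; _*_; _∸_; _/_; _%_; _≤_; _<_; z≤n; s≤s; z<s; s<s; _!; NonZero)
open import Data.Nat.DivMod using
  (m≡m%n+[m/n]*n; m/n*n≤m; /-monoˡ-≤; m*n/n≡m; m%n<n; n/n≡1; m<n⇒m/n≡0; +-distrib-/-∣ʳ)
open import Data.Nat.Divisibility using (n∣m*n)
open import Data.Nat.Tactic.RingSolver using (solve-∀)
open import Data.Nat.ListAction using (sum)
import Data.Nat.Properties as ℕ
open import Data.Product.Base using (∃; ∃₂; _×_; _,_; proj₁; proj₂)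
open import Data.Sum.Base using (inj₁; inj₂; [_,_])
open import Function.Base using (_∘_; id)
open import Function.Bundles using (_⇔_; mk⇔; module Equivalence)
open import Function.Construct.Composition using (_⇔-∘_)
open import Relation.Binary.PropositionalEquality using
  (_≡_; _≢_; refl; sym; trans; cong; cong₂; subst; subst₂; module ≡-Reasoning)
open import Relation.Nullary.Decidable using (Dec; yes; no; does; ¬?)
open import Relation.Nullary.Negation using (¬_; contradiction)
open import Relation.Unary using (Decidable)
open import Data.Vec.Base using (Vec; []; _∷_; toList)
open import Data.Vec.Properties using (length-toList)
import Data.Integer.Base as ℤ
import Data.Integer.Properties as ℤ
open import Data.Rational.Base as ℚ using (ℚ)
import Data.Rational.Properties as ℚ
open import Data.Rational.Unnormalised.Base as ℚᵘ using (mkℚᵘ; *≡*)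
import Data.Rational.Unnormalised.Properties as ℚᵘ
open import Defs

open Equivalence using (to; from)

private variable
  A B : Set
  n : ℕ

-- Duplicate-free lists with the same members are permutations of each other. The bijective counts
-- below rest on this.
length-≡ : {xs ys : List A} → Unique xs → Unique ys →
  (∀ {z} → z ∈ xs ⇔ z ∈ ys) → length xs ≡ length ys
length-≡ xs! ys! xs∼ys = ↭-length (∼bag⇒↭ (unique∧set⇒bag xs! ys! xs∼ys))

-- Sums over lists

∑ : List A → (A → ℕ) → ℕ
∑ xs f = sum (map f xs)

∑-cong : (xs : List A) {f g : A → ℕ} →
  (∀ {x} → x ∈ xs → f x ≡ g x) → ∑ xs f ≡ ∑ xs g
∑-cong []       eq = refl
∑-cong (x ∷ xs) eq = cong₂ _+_ (eq (here refl)) (∑-cong xs (eq ∘ there))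

∑-zero : (xs : List A) {f : A → ℕ} → (∀ {x} → x ∈ xs → f x ≡ 0) → ∑ xs f ≡ 0
∑-zero []       eq = refl
∑-zero (x ∷ xs) eq = cong₂ _+_ (eq (here refl)) (∑-zero xs (eq ∘ there))

∑-distrib-+ : (xs : List A) (f g : A → ℕ) →
  ∑ xs (λ x → f x + g x) ≡ ∑ xs f + ∑ xs g
∑-distrib-+ []       f g = refl
∑-distrib-+ (x ∷ xs) f g = begin
  f x + g x + ∑ xs (λ x → f x + g x)  ≡⟨ cong (f x + g x +_) (∑-distrib-+ xs f g) ⟩
  f x + g x + (∑ xs f + ∑ xs g)       ≡⟨ ℕ.+-assoc (f x) (g x) _ ⟩
  f x + (g x + (∑ xs f + ∑ xs g))     ≡⟨ cong (f x +_) (ℕ.+-comm (g x) _) ⟩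
  f x + (∑ xs f + ∑ xs g + g x)       ≡⟨ cong (f x +_) (ℕ.+-assoc (∑ xs f) _ _) ⟩
  f x + (∑ xs f + (∑ xs g + g x))     ≡⟨ cong (λ k → f x + (∑ xs f + k)) (ℕ.+-comm _ (g x)) ⟩
  f x + (∑ xs f + (g x + ∑ xs g))     ≡⟨ ℕ.+-assoc (f x) _ _ ⟨
  f x + ∑ xs f + (g x + ∑ xs g)       ∎
  where open ≡-Reasoning

∑-distribʳ-* : (xs : List A) (f : A → ℕ) (c : ℕ) →
  ∑ xs (λ x → f x * c) ≡ ∑ xs f * c
∑-distribʳ-* []       f c = refl
∑-distribʳ-* (x ∷ xs) f c =
  trans (cong (f x * c +_) (∑-distribʳ-* xs f c)) (sym (ℕ.*-distribʳ-+ c (f x) _))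

∑-comm : (xs : List A) (ys : List B) (f : A → B → ℕ) →
  ∑ xs (λ x → ∑ ys (f x)) ≡ ∑ ys (λ y → ∑ xs (λ x → f x y))
∑-comm []       ys f = sym (∑-zero ys (λ _ → refl))
∑-comm (x ∷ xs) ys f =
  trans (cong (∑ ys (f x) +_) (∑-comm xs ys f)) (sym (∑-distrib-+ ys (f x) _))

∑-map : (xs : List A) (h : A → B) (f : B → ℕ) → ∑ (map h xs) f ≡ ∑ xs (f ∘ h)
∑-map xs h f = cong sum (sym (map-∘ xs))

∑-upTo-suc : (l : ℕ) (f : ℕ → ℕ) → ∑ (upTo (suc l)) f ≡ f 0 + ∑ (upTo l) (f ∘ suc)
∑-upTo-suc l f = cong (λ xs → f 0 + sum xs)
  (trans (map-applyUpTo suc f l) (sym (map-applyUpTo id (f ∘ suc) l)))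

-- Indicators and counting with filtered lists

𝟙 : {P : Set} → Dec P → ℕ
𝟙 P? = if does P? then 1 else 0

𝟙-yes : {P : Set} (P? : Dec P) → P → 𝟙 P? ≡ 1
𝟙-yes (yes _) p = refl
𝟙-yes (no ¬p) p = contradiction p ¬p

𝟙-no : {P : Set} (P? : Dec P) → ¬ P → 𝟙 P? ≡ 0
𝟙-no (yes p) ¬p = contradiction p ¬p
𝟙-no (no _)  ¬p = refl

unless : {P : Set} → Dec P → ℕ → ℕ
unless P? k = if does P? then 0 else k

unless-yes : {P : Set} (P? : Dec P) {k : ℕ} → P → unless P? k ≡ 0
unless-yes (yes _) p = refl
unless-yes (no ¬p) p = contradiction p ¬p

unless-no : {P : Set} (P? : Dec P) {k : ℕ} → ¬ P → unless P? k ≡ k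
unless-no (yes p) ¬p = contradiction p ¬p
unless-no (no _)  ¬p = refl

length-filter≡∑ : {P : A → Set} (P? : Decidable P) (xs : List A) →
  length (filter P? xs) ≡ ∑ xs (𝟙 ∘ P?)
length-filter≡∑ P? []       = refl
length-filter≡∑ P? (x ∷ xs) with does (P? x)
... | true  = cong suc (length-filter≡∑ P? xs)
... | false = length-filter≡∑ P? xs

𝟙-cong : {P Q : Set} (P? : Dec P) (Q? : Dec Q) → P ⇔ Q → 𝟙 P? ≡ 𝟙 Q?
𝟙-cong (yes p) Q? P⇔Q = sym (𝟙-yes Q? (to P⇔Q p))
𝟙-cong (no ¬p) Q? P⇔Q = sym (𝟙-no Q? (¬p ∘ from P⇔Q))

∑-restrict : {P : A → Set} (P? : Decidable P) (xs : List A) {f : A → ℕ} →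
  (∀ {x} → ¬ P x → f x ≡ 0) → ∑ (filter P? xs) f ≡ ∑ xs f
∑-restrict P? []       f≡0 = refl
∑-restrict P? (x ∷ xs) {f} f≡0 with P? x
... | yes _ = cong (f x +_) (∑-restrict P? xs f≡0)
... | no ¬p = cong₂ _+_ (sym (f≡0 ¬p)) (∑-restrict P? xs f≡0)

length-filter-cartesianProductWith : {C : Set} {P : C → Set} (P? : Decidable P)
  (f : A → B → C) (xs : List A) (ys : List B) →
  length (filter P? (cartesianProductWith f xs ys)) ≡ ∑ xs (λ x → length (filter (P? ∘ f x) ys))
length-filter-cartesianProductWith P? f []       ys = refl
length-filter-cartesianProductWith P? f (x ∷ xs) ys = begin
  length (filter P? (map (f x) ys ++ cartesianProductWith f xs ys))
    ≡⟨ cong length (filter-++ P? (map (f x) ys) _) ⟩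
  length (filter P? (map (f x) ys) ++ filter P? (cartesianProductWith f xs ys))
    ≡⟨ length-++ (filter P? (map (f x) ys)) ⟩
  length (filter P? (map (f x) ys)) + length (filter P? (cartesianProductWith f xs ys))
    ≡⟨ cong₂ _+_
         (trans (length-filter≡∑ P? (map (f x) ys))
           (trans (∑-map ys (f x) _) (sym (length-filter≡∑ (P? ∘ f x) ys))))
         (length-filter-cartesianProductWith P? f xs ys) ⟩
  length (filter (P? ∘ f x) ys) + ∑ xs (λ x → length (filter (P? ∘ f x) ys))  ∎
  where open ≡-Reasoning

-- Both sides sum the indicator of `R` over all pairs, in the two possible orders.
double-count : {R : A → B → Set} (R? : ∀ x y → Dec (R x y)) (xs : List A) (ys : List B) →
  ∑ xs (λ x → length (filter (R? x) ys)) ≡ ∑ ys (λ y → length (filter (λ x → R? x y) xs))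
double-count R? xs ys = begin
  ∑ xs (λ x → length (filter (R? x) ys))          ≡⟨ ∑-cong xs (λ _ → length-filter≡∑ _ ys) ⟩
  ∑ xs (λ x → ∑ ys (λ y → 𝟙 (R? x y)))            ≡⟨ ∑-comm xs ys _ ⟩
  ∑ ys (λ y → ∑ xs (λ x → 𝟙 (R? x y)))            ≡⟨ ∑-cong ys (λ _ → length-filter≡∑ _ xs) ⟨
  ∑ ys (λ y → length (filter (λ x → R? x y) xs))  ∎
  where open ≡-Reasoning

∑-filter : {P : A → Set} (P? : Decidable P) (xs : List A) {f : A → ℕ} {c : ℕ} →
  (∀ {x} → x ∈ xs → P x → f x ≡ c) → (∀ {x} → x ∈ xs → ¬ P x → f x ≡ 0) →
  ∑ xs f ≡ length (filter P? xs) * c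
∑-filter P? []       f≡c f≡0 = refl
∑-filter P? (x ∷ xs) f≡c f≡0 with P? x
... | yes px = cong₂ _+_ (f≡c (here refl) px) (∑-filter P? xs (f≡c ∘ there) (f≡0 ∘ there))
... | no ¬px = cong₂ _+_ (f≡0 (here refl) ¬px) (∑-filter P? xs (f≡c ∘ there) (f≡0 ∘ there))

-- Arithmetic progressions

-- The difference is `suc d`, hence positive for every `d`, and distinct indices give distinct
-- terms.
progression : ℕ → ℕ → ℕ → List ℕ
progression a d l = applyUpTo (λ t → a + t * suc d) l

term-injective : ∀ a d {s t} → a + s * suc d ≡ a + t * suc d → s ≡ t
term-injective a d {s} {t} eq = ℕ.*-cancelʳ-≡ s t (suc d) (ℕ.+-cancelˡ-≡ a _ _ eq)

term-monoʳ-< : ∀ a d {s t} → s < t → a + s * suc d < a + t * suc d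
term-monoʳ-< a d s<t = ℕ.+-monoʳ-< a (ℕ.*-monoˡ-< (suc d) s<t)

term-cancel-< : ∀ a d {s t} → a + s * suc d < a + t * suc d → s < t
term-cancel-< a d {s} {t} lt = ℕ.*-cancelʳ-< (suc d) s t (ℕ.+-cancelˡ-< a _ _ lt)

progression⁺ : ∀ a d l → Unique (progression a d l)
progression⁺ a d l = applyUpTo⁺₁ _ l λ s<t _ → ℕ.<⇒≢ s<t ∘ term-injective a d

∈-progression⁺ : ∀ a d {l t} → t < l → a + t * suc d ∈ progression a d l
∈-progression⁺ a d = ∈-applyUpTo⁺ (λ t → a + t * suc d)

∈-progression⁻ : ∀ a d {l v} → v ∈ progression a d l → ∃ λ t → t < l × v ≡ a + t * suc d
∈-progression⁻ a d = ∈-applyUpTo⁻ (λ t → a + t * suc d)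

-- Used to see that `m` steps of length `q` fit between 0 and `l` exactly for `q` up to `l / m`.
*-≤⇔≤-/ : ∀ q l m .{{_ : NonZero m}} → q * m ≤ l ⇔ q ≤ l / m
*-≤⇔≤-/ q l m = mk⇔
  (λ le → subst (_≤ l / m) (m*n/n≡m q m) (/-monoˡ-≤ m le))
  (λ le → ℕ.≤-trans (ℕ.*-monoˡ-≤ m le) (m/n*n≤m l m))

-- The pairs (a , d) for which progression a d (suc m) ends in l.
progressionsTo : ∀ m .{{_ : NonZero m}} → ℕ → List (ℕ × ℕ)
progressionsTo m l = map (λ t → l ∸ m * suc t , t) (upTo (l / m))

-- The pairs (a , d) for which progression a d (suc m) lies below l.
progressions : ∀ m .{{_ : NonZero m}} → ℕ → List (ℕ × ℕ)
progressions m zero    = []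
progressions m (suc l) =
  progressionsTo m l ++ progressions m l

module _ (m : ℕ) .{{_ : NonZero m}} where

  ∈-progressions⁻ : ∀ l {a d} → (a , d) ∈ progressions m l → a + m * suc d < l
  ∈-progressions⁻ (suc l) p∈ with ∈-++⁻ (progressionsTo m l) p∈
  ... | inj₂ p∈′ = ℕ.m≤n⇒m≤1+n (∈-progressions⁻ l p∈′)
  ... | inj₁ p∈′ with ∈-map⁻ _ p∈′
  -- The truncated subtraction in the start `l ∸ m * suc t` is exact, because `t < l / m` gives
  -- `suc t * m ≤ l`.
  ...   | t , t∈ , refl = s≤s (ℕ.≤-reflexive (ℕ.m∸n+n≡m
            (subst (_≤ l) (ℕ.*-comm (suc t) m) (from (*-≤⇔≤-/ (suc t) l m) (∈-upTo⁻ t∈)))))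

  ∈-progressions⁺ : ∀ l {a d} → a + m * suc d < l → (a , d) ∈ progressions m l
  ∈-progressions⁺ (suc l) {a} {d} (s≤s le) with ℕ.m≤n⇒m<n∨m≡n le
  ... | inj₁ lt   = ∈-++⁺ʳ (progressionsTo m l) (∈-progressions⁺ l lt)
  ... | inj₂ refl = ∈-++⁺ˡ (subst (λ b → (b , d) ∈ progressionsTo m l) (ℕ.m+n∸n≡m a (m * suc d))
          (∈-map⁺ (λ t → l ∸ m * suc t , t) (∈-upTo⁺ (to (*-≤⇔≤-/ (suc d) l m)
            (subst (_≤ l) (ℕ.*-comm m (suc d)) (ℕ.m≤n+m (m * suc d) a))))))

  progressions⁺ : ∀ l → Unique (progressions m l)
  progressions⁺ zero    = []
  progressions⁺ (suc l) = Unique.++⁺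
    (Unique.map⁺ (cong proj₂) (upTo⁺ (l / m))) (progressions⁺ l) disjoint
    where
    disjoint : Disjoint (progressionsTo m l) (progressions m l)
    -- A pair in both blocks would have its last term equal to `l` and also below `l`.
    disjoint {a , d} (p∈ , p∈′) with ∈-map⁻ _ p∈
    ... | t , t∈ , refl = ℕ.<-irrefl (ℕ.m∸n+n≡m
            (subst (_≤ l) (ℕ.*-comm (suc t) m) (from (*-≤⇔≤-/ (suc t) l m) (∈-upTo⁻ t∈))))
            (∈-progressions⁻ l p∈′)

  length-progressions-suc : ∀ l →
    length (progressions m (suc l)) ≡ l / m + length (progressions m l)
  length-progressions-suc l = trans (length-++ (map _ (upTo (l / m))))
    (cong (_+ length (progressions m l)) (trans (length-map _ (upTo (l / m))) (length-upTo (l / m))))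

-- The letters left by a list of used letters

-- By definition `remaining j u` is `left (take j (toList u))`, so facts about lists of used letters
-- apply to `𝒟` directly.
left : List (Fin n) → Subset n
left ys = ∁ (⋃ (map ⁅_⁆ ys))

∈⋃⇔∈ : {x : Fin n} (ys : List (Fin n)) → x Subset.∈ ⋃ (map ⁅_⁆ ys) ⇔ x ∈ ys
∈⋃⇔∈ []       = mk⇔ (λ x∈⊥ → contradiction x∈⊥ Subset.∉⊥) λ ()
∈⋃⇔∈ (y ∷ ys) = mk⇔
  ([ here ∘ Subset.x∈⁅y⁆⇒x≡y y , there ∘ to (∈⋃⇔∈ ys) ] ∘ Subset.x∈p∪q⁻ ⁅ y ⁆ _)
  λ { (here refl)  → Subset.x∈p∪q⁺ (inj₁ (Subset.x∈⁅x⁆ y))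
    ; (there x∈ys) → Subset.x∈p∪q⁺ (inj₂ (from (∈⋃⇔∈ ys) x∈ys)) }

∈left⇔∉ : {x : Fin n} (ys : List (Fin n)) → x Subset.∈ left ys ⇔ x ∉ ys
∈left⇔∉ ys = mk⇔
  (λ x∈ x∈ys → Subset.x∈∁p⇒x∉p x∈ (from (∈⋃⇔∈ ys) x∈ys))
  (λ x∉ys → Subset.x∉p⇒x∈∁p (x∉ys ∘ to (∈⋃⇔∈ ys)))

module _ {n : ℕ} where
  open DecMembership (Fin._≟_ {n}) public using () renaming (_∈?_ to _∈Fin?_)

open DecMembership ℕ._≟_ using () renaming (_∈?_ to _∈ℕ?_)

-- The set `left ys` again, now as an increasing list without repetitions, over which sums can be
-- taken.
rest : List (Fin n) → List (Fin n)
rest ys = filter (λ x → ¬? (x ∈Fin? ys)) (allFin _)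

∈rest⇔∉ : {x : Fin n} (ys : List (Fin n)) → x ∈ rest ys ⇔ x ∉ ys
∈rest⇔∉ ys = mk⇔
  (proj₂ ∘ ∈-filter⁻ (λ x → ¬? (x ∈Fin? ys)) {xs = allFin _})
  (∈-filter⁺ (λ x → ¬? (x ∈Fin? ys)) (∈-allFin _))

rest⁺ : (ys : List (Fin n)) → Unique (rest ys)
rest⁺ ys = Unique.filter⁺ _ (allFin⁺ _)

-- Together `ys` and `rest ys` contain every letter exactly once.
length-rest : {ys : List (Fin n)} → Unique ys → length ys + length (rest ys) ≡ n
length-rest {n} {ys} ys! = begin
  length ys + length (rest ys)  ≡⟨ length-++ ys ⟨
  length (ys ++ rest ys)        ≡⟨ length-≡ (Unique.++⁺ ys! (rest⁺ ys) disjoint) (allFin⁺ n)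
                                     (mk⇔ (λ _ → ∈-allFin _) (λ _ → total _)) ⟩
  length (allFin n)             ≡⟨ length-tabulate {n = n} id ⟩
  n                             ∎
  where
  open ≡-Reasoning
  disjoint : Disjoint ys (rest ys)
  disjoint (x∈ys , x∈rest) = to (∈rest⇔∉ ys) x∈rest x∈ys
  total : ∀ x → x ∈ ys ++ rest ys
  total x with x ∈Fin? ys
  ... | yes x∈ys = ∈-++⁺ˡ x∈ys
  ... | no  x∉ys = ∈-++⁺ʳ ys (from (∈rest⇔∉ ys) x∉ys)

-- Periodic subsets are arithmetic progressions

1<∣p∣ : {p : Subset n} {x y : Fin n} → x Subset.∈ p → y Subset.∈ p → x ≢ y → 1 < Subset.∣ p ∣
1<∣p∣ x∈p y∈p x≢y = ℕ.≤-<-trans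
  (ℕ.≤-<-trans z≤n (Subset.x∈p⇒∣p-x∣<∣p∣ (Subset.x∈p∧x≢y⇒x∈p-y x∈p x≢y)))
  (Subset.x∈p⇒∣p-x∣<∣p∣ y∈p)

-- Consecutive elements are terms with indices `s < t`. If `s + 1 < t`, the term with index `s + 1`
-- would lie strictly between them, so `t = s + 1` and every gap is `suc d`. Since `2 ≤ l`, the
-- first two terms show that `p` is large enough.
progression-periodic : (p : Subset n) (a d : ℕ) {l : ℕ} → 2 ≤ l →
  (∀ {v} → v ∈ progression a d l → v < n) →
  (∀ x → x Subset.∈ p ⇔ toℕ x ∈ progression a d l) → Periodic p
progression-periodic {n} p a d {l} 2≤l bounded p∼ =
  1<∣p∣ (term∈ 0<l) (term∈ 2≤l) first≢second ,
  λ _ _ _ _ c c′ → trans (gap c) (sym (gap c′))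
  where
  0<l = ℕ.<⇒≤ 2≤l
  term : ∀ {t} → t < l → Fin n
  term t<l = fromℕ< (bounded (∈-progression⁺ a d t<l))
  toℕ-term : ∀ {t} (t<l : t < l) → toℕ (term t<l) ≡ a + t * suc d
  toℕ-term t<l = Fin.toℕ-fromℕ< (bounded (∈-progression⁺ a d t<l))
  term∈ : ∀ {t} (t<l : t < l) → term t<l Subset.∈ p
  term∈ t<l = from (p∼ _) (subst (_∈ progression a d l) (sym (toℕ-term t<l)) (∈-progression⁺ a d t<l))
  first≢second : term 0<l ≢ term 2≤l
  first≢second eq with term-injective a d {0} {1}
    (trans (sym (toℕ-term 0<l)) (trans (cong toℕ eq) (toℕ-term 2≤l)))
  ... | ()
  gap : ∀ {x y} → Consecutive p x y → toℕ y ∸ toℕ x ≡ suc d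
  gap {x} {y} (x∈p , y∈p , x<y , none)
    with s , s<l , x≡ ← ∈-progression⁻ a d (to (p∼ x) x∈p)
       | t , t<l , y≡ ← ∈-progression⁻ a d (to (p∼ y) y∈p)
    with s<t ← term-cancel-< a d {s} {t} (subst₂ _<_ x≡ y≡ x<y)
    with ℕ.m≤n⇒m<n∨m≡n s<t
  ... | inj₁ s+1<t = contradiction (term∈ s+1<l) (none (term s+1<l)
          (subst₂ _<_ (sym x≡) (sym (toℕ-term s+1<l)) (term-monoʳ-< a d (ℕ.n<1+n s)))
          (subst₂ _<_ (sym (toℕ-term s+1<l)) (sym y≡) (term-monoʳ-< a d s+1<t)))
    where s+1<l = ℕ.<-trans s+1<t t<l
  ... | inj₂ refl = begin
    toℕ y ∸ toℕ x                            ≡⟨ cong₂ _∸_ y≡ x≡ ⟩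
    a + (suc d + s * suc d) ∸ (a + s * suc d)  ≡⟨ ℕ.[m+n]∸[m+o]≡n∸o a _ _ ⟩
    suc d + s * suc d ∸ s * suc d              ≡⟨ ℕ.m+n∸n≡m (suc d) (s * suc d) ⟩
    suc d                                      ∎
    where open ≡-Reasoning

Adjacent : List (Fin n) → Fin n → Fin n → Set
Adjacent xs x y = x ∈ xs × y ∈ xs × x Fin.< y × (∀ {z} → z ∈ xs → x Fin.< z → ¬ z Fin.< y)

sorted⇒adjacent : {xs : List (Fin n)} → AllPairs Fin._<_ xs → Linked (Adjacent xs) xs
sorted⇒adjacent {xs = []}         []  = []
sorted⇒adjacent {xs = _ ∷ []}     _   = [-]
sorted⇒adjacent {xs = x ∷ y ∷ xs} ((x<y ∷ x<xs) ∷ (y<xs ∷ xs↗)) =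
  (here refl , there (here refl) , x<y , none) ∷
  Linked.map widen (sorted⇒adjacent (y<xs ∷ xs↗))
  where
  none : ∀ {z} → z ∈ x ∷ y ∷ xs → x Fin.< z → ¬ z Fin.< y
  none (here refl)         x<x _   = ℕ.<-irrefl refl x<x
  none (there (here refl)) _   y<y = ℕ.<-irrefl refl y<y
  none (there (there z∈))  _   z<y = ℕ.<-asym z<y (All.lookup y<xs z∈)
  -- The new head lies below all later entries, so it cannot separate two of them.
  widen : ∀ {u v} → Adjacent (y ∷ xs) u v → Adjacent (x ∷ y ∷ xs) u v
  widen (u∈ , v∈ , u<v , none′) = there u∈ , there v∈ , u<v ,
    λ { (here refl) u<x _ → ℕ.<-asym u<x (All.lookup (x<y ∷ x<xs) u∈)
      ; (there z∈) → none′ z∈ }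

-- Stated for any `f` growing by `d` at each step, so that the induction can pass to `f ∘ suc`.
linked⇒applyUpTo : ∀ {d x xs} (f : ℕ → ℕ) → f 0 ≡ x → (∀ t → f (suc t) ≡ f t + d) →
  Linked (λ x y → y ≡ x + d) (x ∷ xs) → x ∷ xs ≡ applyUpTo f (suc (length xs))
linked⇒applyUpTo f refl step [-]         = refl
linked⇒applyUpTo f refl step (refl ∷ ls) =
  cong (f 0 ∷_) (linked⇒applyUpTo (f ∘ suc) (step 0) (step ∘ suc) ls)

-- Neighbours in the sorted list `rest ys` are consecutive elements of `left ys`, so by periodicity
-- each gap equals the first one.
periodic⇒progression : (ys : List (Fin n)) → Periodic (left ys) → 2 ≤ length (rest ys) →
  ∃₂ λ a d → map toℕ (rest ys) ≡ progression a d (length (rest ys))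
periodic⇒progression {n} ys (_ , uniform) 2≤l = go (rest ys) linked 2≤l
  where
  consecutive : ∀ {x y} → Adjacent (rest ys) x y → Consecutive (left ys) x y
  consecutive (x∈ , y∈ , x<y , none) = rest⊆left x∈ , rest⊆left y∈ , x<y ,
    λ z x<z z<y z∈ → none (from (∈rest⇔∉ ys) (to (∈left⇔∉ ys) z∈)) x<z z<y
    where
    rest⊆left : ∀ {x} → x ∈ rest ys → x Subset.∈ left ys
    rest⊆left = from (∈left⇔∉ ys) ∘ to (∈rest⇔∉ ys)
  linked : Linked (Consecutive (left ys)) (rest ys)
  linked = Linked.map consecutive (sorted⇒adjacent
    (AllPairs.filter⁺ (λ x → ¬? (x ∈Fin? ys)) (AllPairs.tabulate⁺-< {f = id} id)))
  go : ∀ xs → Linked (Consecutive (left ys)) xs → 2 ≤ length xs →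
    ∃₂ λ a d → map toℕ xs ≡ progression a d (length xs)
  go (_ ∷ [])     _ (s≤s ())
  go (x ∷ y ∷ xs) ls@(c@(_ , _ , x<y , _) ∷ _) _ = toℕ x , δ ,
    trans (linked⇒applyUpTo (λ t → toℕ x + t * suc δ) (ℕ.+-identityʳ _) step
             (Linked.map⁺ (Linked.map gap ls)))
          (cong (progression (toℕ x) δ ∘ suc) (length-map toℕ (y ∷ xs)))
    where
    -- The predecessor of the first gap, since `progression` takes its difference minus one.
    δ = toℕ y ∸ suc (toℕ x)
    1+δ : toℕ y ∸ toℕ x ≡ suc δ
    1+δ = ℕ.+-∸-assoc 1 x<y
    gap : ∀ {u v} → Consecutive (left ys) u v → toℕ v ≡ toℕ u + suc δ
    gap {u} c′@(_ , _ , u<v , _) = trans (sym (ℕ.m+[n∸m]≡n (ℕ.<⇒≤ u<v)))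
      (cong (toℕ u +_) (trans (uniform _ _ _ _ c′ c) 1+δ))
    step : ∀ t → toℕ x + suc t * suc δ ≡ toℕ x + t * suc δ + suc δ
    step t = trans (cong (toℕ x +_) (ℕ.+-comm (suc δ) _)) (sym (ℕ.+-assoc (toℕ x) _ _))

-- Progressions avoiding the used letters

module _ (m : ℕ) .{{_ : NonZero m}} where

  length-progressions-≤ : ∀ {l} → l ≤ m → length (progressions m l) ≡ 0
  length-progressions-≤ {zero}  _   = refl
  length-progressions-≤ {suc l} l<m = trans (length-progressions-suc m l)
    (cong₂ _+_ (m<n⇒m/n≡0 l<m) (length-progressions-≤ (ℕ.<⇒≤ l<m)))

  -- The only candidate is 0, 1, ..., `m`. This settles the case in which just `m + 1` letters
  -- remain.
  length-progressions-suc-m : length (progressions m (suc m)) ≡ 1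
  length-progressions-suc-m = trans (length-progressions-suc m m)
    (cong₂ _+_ (n/n≡1 m) (length-progressions-≤ ℕ.≤-refl))

[r+q*m]/m≡q : ∀ q r m .{{_ : NonZero m}} → r < m → (r + q * m) / m ≡ q
[r+q*m]/m≡q q r m r<m = trans (+-distrib-/-∣ʳ r (n∣m*n q))
  (cong₂ _+_ (m<n⇒m/n≡0 r<m) (m*n/n≡m q m))

-- The count is q (l + r - m) / 2, stated without division and subtraction.
2*length-progressions : ∀ m .{{_ : NonZero m}} l {q r} → l ≡ r + q * m → r < m →
  2 * length (progressions m l) + m * q ≡ q * (l + r)
2*length-progressions m zero {zero} {r} _ _ = ℕ.*-zeroʳ m
2*length-progressions m@(suc _) zero {suc q} {zero}  () _
2*length-progressions m@(suc _) zero {suc q} {suc r} () _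
-- Here `l` and `suc l` have the same quotient `q`, and the new block adds `l / m = q` progressions.
2*length-progressions m (suc l) {q} {suc r} refl r<m = begin
  2 * length (progressions m (suc l)) + m * q
    ≡⟨ cong (λ k → 2 * k + m * q) (trans (length-progressions-suc m l)
         (cong (_+ c) ([r+q*m]/m≡q q r m r<m′))) ⟩
  2 * (q + c) + m * q            ≡⟨ regroup q c (m * q) ⟩
  q * 2 + (2 * c + m * q)        ≡⟨ cong (q * 2 +_) (2*length-progressions m l {q} {r} refl r<m′) ⟩
  q * 2 + q * (l + r)            ≡⟨ step q l r ⟩
  q * (suc l + suc r)            ∎
  where
  open ≡-Reasoning
  c = length (progressions m l)
  r<m′ = ℕ.<-trans (ℕ.n<1+n r) r<m
  regroup : ∀ q c k → 2 * (q + c) + k ≡ q * 2 + (2 * c + k)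
  regroup = solve-∀
  step : ∀ q l r → q * 2 + q * (l + r) ≡ q * (suc l + suc r)
  step = solve-∀
-- Here `m` divides `suc l`, so `l` has quotient `q` and remainder `m - 1`.
2*length-progressions m@(suc m-1) (suc l) {suc q} {zero} refl r<m = begin
  2 * length (progressions m (suc l)) + m * suc q
    ≡⟨ cong (λ k → 2 * k + m * suc q) (trans (length-progressions-suc m l)
         (cong (_+ c) ([r+q*m]/m≡q q m-1 m (ℕ.n<1+n m-1)))) ⟩
  2 * (q + c) + m * suc q                    ≡⟨ regroup q c m ⟩
  q * 2 + m + (2 * c + m * q)                ≡⟨ cong (q * 2 + m +_)
                                                  (2*length-progressions m l {q} {m-1} refl (ℕ.n<1+n m-1)) ⟩
  q * 2 + m + q * (l + m-1)                  ≡⟨ step q m-1 ⟩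
  suc q * (suc l + 0)                        ∎
  where
  open ≡-Reasoning
  c = length (progressions m l)
  regroup : ∀ q c m → 2 * (q + c) + m * suc q ≡ q * 2 + m + (2 * c + m * q)
  regroup = solve-∀
  step : ∀ q k → q * 2 + suc k + q * (k + q * suc k + k) ≡ suc q * (suc (k + q * suc k) + 0)
  step = solve-∀

module _ (m : ℕ) where

  -- For a progression below `n` this means that it lies in `left ys`. In this form, avoiding
  -- `ys ∷ʳ x` splits into avoiding `ys` and one condition on `x`.
  Avoids : List (Fin n) → ℕ × ℕ → Set
  Avoids ys (a , d) = All (λ y → toℕ y ∉ progression a d (suc m)) ys

  avoids? : (ys : List (Fin n)) (p : ℕ × ℕ) → Dec (Avoids ys p)
  avoids? ys (a , d) = All.all? (λ y → ¬? (toℕ y ∈ℕ? progression a d (suc m))) ys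

  progression-< : ∀ {a d l v} → a + m * suc d < l → v ∈ progression a d (suc m) → v < l
  progression-< {a} {d} last<l v∈ with ∈-progression⁻ a d v∈
  ... | t , s≤s t≤m , refl =
    ℕ.≤-<-trans (ℕ.+-monoʳ-≤ a (ℕ.*-monoˡ-≤ (suc d) t≤m)) last<l

  -- The possible next letters that keep clear of the progression. Filtering by `avoids? (ys ∷ʳ x)`
  -- gives the inner list that `double-count` produces, and makes it empty when the progression
  -- already meets `ys`.
  free : List (Fin n) → ℕ × ℕ → List (Fin n)
  free ys p = filter (λ x → avoids? (ys ∷ʳ x) p) (rest ys)

  module _ {ys : List (Fin n)} {a d : ℕ}
           (last<n : a + m * suc d < n) (avoids : Avoids ys (a , d)) where

    ∈free⁺ : ∀ {x} → x ∉ ys → toℕ x ∉ progression a d (suc m) → x ∈ free ys (a , d)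
    ∈free⁺ {x} x∉ys x∉p = ∈-filter⁺ (λ x → avoids? (ys ∷ʳ x) (a , d))
      (from (∈rest⇔∉ ys) x∉ys) (All.∷ʳ⁺ avoids x∉p)

    ∈free⁻ : ∀ {x} → x ∈ free ys (a , d) → x ∉ ys × toℕ x ∉ progression a d (suc m)
    ∈free⁻ {x} x∈ with ∈-filter⁻ (λ x → avoids? (ys ∷ʳ x) (a , d)) {xs = rest ys} x∈
    ... | x∈rest , avoids′ = to (∈rest⇔∉ ys) x∈rest , proj₂ (All.∷ʳ⁻ avoids′)

    -- The used letters, the terms of the progression and the free letters partition 0, ...,
    -- `n - 1`.
    length-free : Unique ys → length ys + (suc m + length (free ys (a , d))) ≡ n
    length-free ys! = begin
      length ys + (suc m + length (free ys (a , d)))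
        ≡⟨ cong₂ _+_ (length-map toℕ ys)
             (cong₂ _+_ (length-applyUpTo (λ t → a + t * suc d) (suc m))
                        (length-map toℕ (free ys (a , d)))) ⟨
      length (map toℕ ys) + (length (progression a d (suc m)) + length (map toℕ (free ys (a , d))))
        ≡⟨ cong (length (map toℕ ys) +_) (length-++ (progression a d (suc m))) ⟨
      length (map toℕ ys) + length (progression a d (suc m) ++ map toℕ (free ys (a , d)))
        ≡⟨ length-++ (map toℕ ys) ⟨
      length (map toℕ ys ++ progression a d (suc m) ++ map toℕ (free ys (a , d)))
        ≡⟨ length-≡ unique (upTo⁺ n) (mk⇔ bounded total) ⟩
      length (upTo n)
        ≡⟨ length-upTo n ⟩
      n ∎
      where
      open ≡-Reasoning
      disjoint₁ : Disjoint (progression a d (suc m)) (map toℕ (free ys (a , d)))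
      disjoint₁ (v∈p , v∈free) with ∈-map⁻ toℕ v∈free
      ... | x , x∈free , refl = proj₂ (∈free⁻ x∈free) v∈p
      disjoint₂ : Disjoint (map toℕ ys) (progression a d (suc m) ++ map toℕ (free ys (a , d)))
      disjoint₂ (v∈ys , v∈) with ∈-map⁻ toℕ v∈ys | ∈-++⁻ (progression a d (suc m)) v∈
      ... | y , y∈ys , refl | inj₁ y∈p = All.lookup avoids y∈ys y∈p
      ... | y , y∈ys , y≡   | inj₂ v∈free with ∈-map⁻ toℕ v∈free
      ...   | x , x∈free , v≡x = proj₁ (∈free⁻ x∈free)
                (subst (_∈ ys) (Fin.toℕ-injective (trans (sym y≡) v≡x)) y∈ys)
      unique : Unique (map toℕ ys ++ progression a d (suc m) ++ map toℕ (free ys (a , d)))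
      unique = Unique.++⁺ (Unique.map⁺ Fin.toℕ-injective ys!)
        (Unique.++⁺ (progression⁺ a d (suc m))
          (Unique.map⁺ Fin.toℕ-injective (Unique.filter⁺ _ (rest⁺ ys))) disjoint₁)
        disjoint₂
      bounded : ∀ {v} → v ∈ map toℕ ys ++ progression a d (suc m) ++ map toℕ (free ys (a , d)) → v ∈ upTo n
      bounded v∈ with ∈-++⁻ (map toℕ ys) v∈
      ... | inj₁ v∈ys with ∈-map⁻ toℕ v∈ys
      ...   | y , _ , refl = ∈-upTo⁺ (Fin.toℕ<n y)
      bounded v∈ | inj₂ v∈′ with ∈-++⁻ (progression a d (suc m)) v∈′
      ... | inj₁ v∈p = ∈-upTo⁺ (progression-< last<n v∈p)
      ... | inj₂ v∈free with ∈-map⁻ toℕ v∈free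
      ...   | x , _ , refl = ∈-upTo⁺ (Fin.toℕ<n x)
      total′ : ∀ x → toℕ x ∈ map toℕ ys ++ progression a d (suc m) ++ map toℕ (free ys (a , d))
      total′ x with x ∈Fin? ys | toℕ x ∈ℕ? progression a d (suc m)
      ... | yes x∈ys | _       = ∈-++⁺ˡ (∈-map⁺ toℕ x∈ys)
      ... | no  _    | yes x∈p = ∈-++⁺ʳ (map toℕ ys) (∈-++⁺ˡ x∈p)
      ... | no  x∉ys | no  x∉p = ∈-++⁺ʳ (map toℕ ys) (∈-++⁺ʳ (progression a d (suc m))
                                   (∈-map⁺ toℕ (∈free⁺ x∉ys x∉p)))
      total : ∀ {v} → v ∈ upTo n → v ∈ map toℕ ys ++ progression a d (suc m) ++ map toℕ (free ys (a , d))
      total v∈ = subst (_∈ _) (Fin.toℕ-fromℕ< (∈-upTo⁻ v∈)) (total′ _)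

    -- The used letters and the `m + 1` terms already account for all `n` letters, so none is free
    -- and `left ys` is the progression itself.
    avoids⇒periodic : Unique ys → length ys + suc m ≡ n → 1 ≤ m → Periodic (left ys)
    avoids⇒periodic ys! len 1≤m = progression-periodic (left ys) a d (s≤s 1≤m) (progression-< last<n)
      λ x → mk⇔ (left⊆p x ∘ to (∈left⇔∉ ys))
                (λ x∈p → from (∈left⇔∉ ys) (λ x∈ys → All.lookup avoids x∈ys x∈p))
      where
      length-free≡0 : length (free ys (a , d)) ≡ 0
      length-free≡0 = ℕ.+-cancelˡ-≡ (suc m) _ _ (trans
        (ℕ.+-cancelˡ-≡ (length ys) _ _ (trans (length-free ys!) (sym len))) (sym (ℕ.+-identityʳ (suc m))))
      free-empty : ∀ {xs : List (Fin n)} {x} → length xs ≡ 0 → x ∉ xs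
      free-empty {[]} _ ()
      left⊆p : ∀ x → x ∉ ys → toℕ x ∈ progression a d (suc m)
      left⊆p x x∉ys with toℕ x ∈ℕ? progression a d (suc m)
      ... | yes x∈p = x∈p
      ... | no  x∉p = contradiction (∈free⁺ x∉ys x∉p) (free-empty length-free≡0)

-- Progressions inside a progression

module _ (m : ℕ) .{{_ : NonZero m}} where

  -- The affine map from the index `s` to `a + s * suc d` carries the progressions below `l`
  -- bijectively to those contained in `rest ys`.
  length-avoiding-progression : (ys : List (Fin n)) {a d l : ℕ} →
    map toℕ (rest ys) ≡ progression a d l →
    length (filter (avoids? m ys) (progressions m n)) ≡ length (progressions m l)
  length-avoiding-progression {n} ys {a} {d} {l} rest≡ = trans
    (length-≡ (Unique.filter⁺ _ (progressions⁺ m n))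
              (Unique.map⁺ rescale-injective (progressions⁺ m l))
              (mk⇔ inside outside))
    (length-map rescale (progressions m l))
    where
    rescale : ℕ × ℕ → ℕ × ℕ
    -- The second entry is chosen so that its successor is `suc t * suc d`, the difference `suc t`
    -- stretched by `suc d`.
    rescale (x , t) = a + x * suc d , d + t * suc d

    rescale-injective : ∀ {p q} → rescale p ≡ rescale q → p ≡ q
    rescale-injective eq = cong₂ _,_
      (term-injective a d (cong proj₁ eq)) (term-injective d d (cong proj₂ eq))

    rescale-term : ∀ x t s → a + x * suc d + s * (suc t * suc d) ≡ a + (x + s * suc t) * suc d
    rescale-term x t s = expand a x s (suc t) (suc d)
      where
      expand : ∀ a x s u v → a + x * v + s * (u * v) ≡ a + (x + s * u) * v
      expand = solve-∀

    ∉ys⇒∈ : ∀ {x} → x ∉ ys → toℕ x ∈ progression a d l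
    ∉ys⇒∈ x∉ys = subst (_ ∈_) rest≡ (∈-map⁺ toℕ (from (∈rest⇔∉ ys) x∉ys))

    ∈⇒∉ys : ∀ {v} → v ∈ progression a d l → ∃ λ x → x ∉ ys × v ≡ toℕ x
    ∈⇒∉ys v∈ with ∈-map⁻ toℕ (subst (_ ∈_) (sym rest≡) v∈)
    ... | x , x∈ , v≡ = x , to (∈rest⇔∉ ys) x∈ , v≡

    avoids⇒term : ∀ {b e} → b + m * suc e < n → Avoids m ys (b , e) →
      ∀ {s} → s ≤ m → ∃ λ t → t < l × b + s * suc e ≡ a + t * suc d
    avoids⇒term {b} {e} last<n avoids {s} s≤m = ∈-progression⁻ a d
      (subst (_∈ progression a d l) (Fin.toℕ-fromℕ< s<n) (∉ys⇒∈ λ x∈ys →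
        All.lookup avoids x∈ys
          (subst (_∈ progression b e (suc m)) (sym (Fin.toℕ-fromℕ< s<n)) s∈)))
      where
      s∈ = ∈-progression⁺ b e (s≤s s≤m)
      s<n = progression-< m last<n s∈

    inside : ∀ {p} → p ∈ filter (avoids? m ys) (progressions m n) → p ∈ map rescale (progressions m l)
    inside {b , e} p∈
      with p∈′ , avoids ← ∈-filter⁻ (avoids? m ys) {xs = progressions m n} p∈
      -- Three terms suffice: the indices `x` and `y` of the first two give the start and the
      -- difference `y - x` of the preimage, and the index `z` of the last shows that it stays below
      -- `l`. A second term exists because `m` is positive.
      with avoids⇒term (∈-progressions⁻ m n p∈′) avoids z≤n
         | avoids⇒term (∈-progressions⁻ m n p∈′) avoids (ℕ.>-nonZero⁻¹ m)
         | avoids⇒term (∈-progressions⁻ m n p∈′) avoids ℕ.≤-refl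
    ... | x , _ , first≡ | y , _ , second≡ | z , z<l , last≡ =
      subst (_∈ map rescale (progressions m l)) (cong₂ _,_ (sym b≡) (ℕ.suc-injective (sym 1+e≡)))
        (∈-map⁺ rescale (∈-progressions⁺ m l (subst (_< l) z≡ z<l)))
      where
      open ≡-Reasoning
      b≡ : b ≡ a + x * suc d
      b≡ = trans (sym (ℕ.+-identityʳ b)) first≡
      x<y : x < y
      x<y = term-cancel-< a d {x} {y} (subst₂ _<_ first≡ second≡ (term-monoʳ-< b e {0} {1} z<s))
      t = y ∸ suc x
      1+e≡ : suc e ≡ suc t * suc d
      1+e≡ = ℕ.+-cancelˡ-≡ (a + x * suc d) _ _ (begin
        a + x * suc d + suc e            ≡⟨ cong₂ _+_ b≡ (ℕ.*-identityˡ (suc e)) ⟨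
        b + 1 * suc e                    ≡⟨ second≡ ⟩
        a + y * suc d                    ≡⟨ cong (λ k → a + k * suc d) (trans (ℕ.+-suc x t) (ℕ.m+[n∸m]≡n x<y)) ⟨
        a + (x + suc t) * suc d          ≡⟨ cong (λ k → a + (x + k) * suc d) (ℕ.*-identityˡ (suc t)) ⟨
        a + (x + 1 * suc t) * suc d      ≡⟨ rescale-term x t 1 ⟨
        a + x * suc d + 1 * (suc t * suc d) ≡⟨ cong (a + x * suc d +_) (ℕ.*-identityˡ _) ⟩
        a + x * suc d + suc t * suc d    ∎)
      z≡ : z ≡ x + m * suc t
      z≡ = term-injective a d (begin
        a + z * suc d                        ≡⟨ last≡ ⟨
        b + m * suc e                        ≡⟨ cong₂ (λ b k → b + m * k) b≡ 1+e≡ ⟩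
        a + x * suc d + m * (suc t * suc d)  ≡⟨ rescale-term x t m ⟩
        a + (x + m * suc t) * suc d          ∎)

    outside : ∀ {p} → p ∈ map rescale (progressions m l) → p ∈ filter (avoids? m ys) (progressions m n)
    outside p∈ with ∈-map⁻ rescale p∈
    ... | (x , t) , xt∈ , refl = ∈-filter⁺ (avoids? m ys)
      (∈-progressions⁺ m n last<n)
      (All.tabulate λ {y} y∈ys y∈p → y∉ y∈ys (∈-progression⁻ (a + x * suc d) (d + t * suc d) y∈p))
      where
      term : ∀ {s} → s ≤ m → ∃ λ y → y ∉ ys × a + x * suc d + s * (suc t * suc d) ≡ toℕ y
      term {s} s≤m with ∈⇒∉ys (∈-progression⁺ a d (ℕ.≤-<-trans
        (ℕ.+-monoʳ-≤ x (ℕ.*-monoˡ-≤ (suc t) s≤m)) (∈-progressions⁻ m l xt∈)))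
      ... | y , y∉ , eq = y , y∉ , trans (rescale-term x t s) eq
      last<n : a + x * suc d + m * (suc t * suc d) < n
      last<n with term ℕ.≤-refl
      ... | y , _ , eq = subst (_< n) (sym eq) (Fin.toℕ<n y)
      y∉ : ∀ {y} → y ∈ ys → ¬ (∃ λ s → s < suc m × toℕ y ≡ a + x * suc d + s * (suc t * suc d))
      y∉ y∈ys (s , s≤s s≤m , y≡) with term s≤m
      ... | z , z∉ys , eq = z∉ys (subst (_∈ ys) (Fin.toℕ-injective (trans y≡ eq)) y∈ys)

-- Words with periodic complement

-- The number of words of length k, with distinct letters outside ys, after
-- which the set of remaining letters is periodic.
endPeriodic : List (Fin n) → ℕ → ℕ
endPeriodic ys zero    = 𝟙 (periodic? (left ys))
endPeriodic ys (suc k) = ∑ (rest ys) λ x → endPeriodic (ys ∷ʳ x) k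

-- The number of those words after which the set of remaining letters is
-- periodic for the first time.
firstPeriodic : List (Fin n) → ℕ → ℕ
firstPeriodic ys zero    = 𝟙 (periodic? (left ys))
firstPeriodic ys (suc k) = unless (periodic? (left ys))
  (∑ (rest ys) λ x → firstPeriodic (ys ∷ʳ x) k)

firstPeriodic-suc-yes : (ys : List (Fin n)) (k : ℕ) → Periodic (left ys) → firstPeriodic ys (suc k) ≡ 0
firstPeriodic-suc-yes ys k = unless-yes (periodic? (left ys))

firstPeriodic-suc-no : (ys : List (Fin n)) (k : ℕ) → ¬ Periodic (left ys) →
  firstPeriodic ys (suc k) ≡ ∑ (rest ys) λ x → firstPeriodic (ys ∷ʳ x) k
firstPeriodic-suc-no ys k = unless-no (periodic? (left ys))

unique-∷ʳ : {ys : List (Fin n)} {x : Fin n} → Unique ys → x ∉ ys → Unique (ys ∷ʳ x)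
unique-∷ʳ ys! x∉ys = Unique.++⁺ ys! ([] ∷ []) λ { (x∈ys , here refl) → x∉ys x∈ys }

length-∷ʳ : (ys : List A) {x : A} {k : ℕ} → length (ys ∷ʳ x) + k ≡ length ys + suc k
length-∷ʳ ys {x} {k} = trans (cong (_+ k) (length-++ ys)) (ℕ.+-assoc (length ys) 1 k)

-- Counting words by the progressions they avoid

module _ (m : ℕ) .{{_ : NonZero m}} where

  length-avoiding : {ys : List (Fin n)} {l : ℕ} → Unique ys → length ys + l ≡ n → 2 ≤ l →
    Periodic (left ys) →
    length (filter (avoids? m ys) (progressions m n)) ≡ length (progressions m l)
  length-avoiding {ys = ys} ys! len 2≤l per
    with refl ← ℕ.+-cancelˡ-≡ (length ys) _ _ (trans len (sym (length-rest ys!)))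
    with a , d , rest≡ ← periodic⇒progression ys per 2≤l =
    length-avoiding-progression m ys {a} {d} rest≡

  2≤j+1+m : ∀ j → 2 ≤ j + suc m
  2≤j+1+m j = ℕ.≤-trans (s≤s (ℕ.>-nonZero⁻¹ m)) (ℕ.m≤n+m (suc m) j)

  -- Induction on `j`. When `m + 1` letters remain, `left ys` is periodic exactly if some
  -- progression avoids `ys`, and then there is only one. Otherwise pairs of a next letter and a
  -- progression avoiding the extended list are counted in two ways: each progression avoiding `ys`
  -- has `suc j` free letters, and any other has none.
  endPeriodic≡avoiding : {ys : List (Fin n)} → Unique ys → ∀ j → length ys + (j + suc m) ≡ n →
    endPeriodic ys j ≡ length (filter (avoids? m ys) (progressions m n)) * j !
  endPeriodic≡avoiding {n} {ys} ys! zero len = trans (lemma (periodic? (left ys))) (sym (ℕ.*-identityʳ _))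
    where
    lemma : (per? : Dec (Periodic (left ys))) →
      𝟙 per? ≡ length (filter (avoids? m ys) (progressions m n))
    lemma (yes per) = sym (trans (length-avoiding ys! len (2≤j+1+m 0) per) (length-progressions-suc-m m))
    lemma (no ¬per) = sym (cong length (filter-none (avoids? m ys) (All.tabulate λ p∈ avoids →
      ¬per (avoids⇒periodic m (∈-progressions⁻ m n p∈) avoids ys! len (ℕ.>-nonZero⁻¹ m)))))
  endPeriodic≡avoiding {n} {ys} ys! (suc j) len = begin
    ∑ (rest ys) (λ x → endPeriodic (ys ∷ʳ x) j)
      ≡⟨ ∑-cong (rest ys) (λ {x} x∈ → endPeriodic≡avoiding (unique-∷ʳ ys! (to (∈rest⇔∉ ys) x∈)) j
           (trans (length-∷ʳ ys) len)) ⟩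
    ∑ (rest ys) (λ x → length (filter (avoids? m (ys ∷ʳ x)) (progressions m n)) * j !)
      ≡⟨ ∑-distribʳ-* (rest ys) _ (j !) ⟩
    ∑ (rest ys) (λ x → length (filter (avoids? m (ys ∷ʳ x)) (progressions m n))) * j !
      ≡⟨ cong (_* j !) (double-count (λ x → avoids? m (ys ∷ʳ x)) (rest ys) (progressions m n)) ⟩
    ∑ (progressions m n) (λ p → length (free m ys p)) * j !
      ≡⟨ cong (_* j !) (∑-filter (avoids? m ys) (progressions m n) count-free none-free) ⟩
    length (filter (avoids? m ys) (progressions m n)) * suc j * j !
      ≡⟨ ℕ.*-assoc (length (filter (avoids? m ys) (progressions m n))) (suc j) (j !) ⟩
    length (filter (avoids? m ys) (progressions m n)) * (suc j) !  ∎
    where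
    open ≡-Reasoning
    count-free : ∀ {p} → p ∈ progressions m n → Avoids m ys p → length (free m ys p) ≡ suc j
    count-free p∈ avoids = ℕ.+-cancelˡ-≡ (suc m) _ _ (trans
      (ℕ.+-cancelˡ-≡ (length ys) _ _
        (trans (length-free m (∈-progressions⁻ m n p∈) avoids ys!) (sym len)))
      (ℕ.+-comm (suc j) (suc m)))
    none-free : ∀ {p} → p ∈ progressions m n → ¬ Avoids m ys p → length (free m ys p) ≡ 0
    none-free _ ¬avoids = cong length (filter-none (λ x → avoids? m (ys ∷ʳ x) _)
      (All.universal (λ x avoids → ¬avoids (proj₁ (All.∷ʳ⁻ avoids))) (rest ys)))

  -- The number of words of length `j` over a periodic set of `j + suc m` letters that leave a
  -- periodic set; in the notation of the theorem, q (r + j + 1) j! / 2 with q and r taken from the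
  -- division of `j + suc m` by `m`.
  progressionWords : ℕ → ℕ
  progressionWords j = length (progressions m (j + suc m)) * j !

  endPeriodic-periodic : {ys : List (Fin n)} → Unique ys → ∀ j → length ys + (j + suc m) ≡ n →
    Periodic (left ys) → endPeriodic ys j ≡ progressionWords j
  endPeriodic-periodic ys! j len per = trans (endPeriodic≡avoiding ys! j len)
    (cong (_* j !) (length-avoiding ys! len (2≤j+1+m j) per))

  -- A word is cut after its first `k` letters, where the remaining set first becomes periodic;
  -- `endPeriodic-periodic` counts the continuations. If `left ys` is periodic, only `k = 0`
  -- contributes; if not, the first letter is split off and the induction hypothesis applies to
  -- `ys ∷ʳ x`.
  endPeriodic-decompose : {ys : List (Fin n)} → Unique ys → ∀ j → length ys + (j + suc m) ≡ n →
    endPeriodic ys j ≡ ∑ (upTo (suc j)) λ k → firstPeriodic ys k * progressionWords (j ∸ k)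
  endPeriodic-decompose {ys = ys} ys! zero len =
    sym (trans (ℕ.+-identityʳ _)
      -- The continuation is empty here, and `progressionWords 0` equals 1.
      (trans (cong (λ k → endPeriodic ys 0 * (k * 1)) (length-progressions-suc-m m))
             (ℕ.*-identityʳ _)))
  endPeriodic-decompose {n} {ys} ys! (suc j) len = trans (lemma (periodic? (left ys)))
    (sym (∑-upTo-suc (suc j) (λ k → firstPeriodic ys k * progressionWords (suc j ∸ k))))
    where
    open ≡-Reasoning
    Goal : Set
    Goal = endPeriodic ys (suc j) ≡ firstPeriodic ys 0 * progressionWords (suc j)
      + ∑ (upTo (suc j)) λ k → firstPeriodic ys (suc k) * progressionWords (j ∸ k)
    lemma : Dec (Periodic (left ys)) → Goal
    lemma (yes per) = begin
      endPeriodic ys (suc j)        ≡⟨ endPeriodic-periodic ys! (suc j) len per ⟩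
      progressionWords (suc j)      ≡⟨ ℕ.*-identityˡ _ ⟨
      1 * progressionWords (suc j)  ≡⟨ ℕ.+-identityʳ _ ⟨
      1 * progressionWords (suc j) + 0
        ≡⟨ cong₂ (λ a b → a * progressionWords (suc j) + b) (𝟙-yes (periodic? (left ys)) per)
             (∑-zero (upTo (suc j)) (λ {k} _ →
               cong (_* progressionWords (j ∸ k)) (firstPeriodic-suc-yes ys k per))) ⟨
      firstPeriodic ys 0 * progressionWords (suc j)
        + ∑ (upTo (suc j)) (λ k → firstPeriodic ys (suc k) * progressionWords (j ∸ k))  ∎
    lemma (no ¬per) = begin
      ∑ (rest ys) (λ x → endPeriodic (ys ∷ʳ x) j)
        ≡⟨ ∑-cong (rest ys) (λ {x} x∈ → endPeriodic-decompose (unique-∷ʳ ys! (to (∈rest⇔∉ ys) x∈)) j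
             (trans (length-∷ʳ ys) len)) ⟩
      ∑ (rest ys) (λ x → ∑ (upTo (suc j)) (λ k → firstPeriodic (ys ∷ʳ x) k * progressionWords (j ∸ k)))
        ≡⟨ ∑-comm (rest ys) (upTo (suc j)) _ ⟩
      ∑ (upTo (suc j)) (λ k → ∑ (rest ys) (λ x → firstPeriodic (ys ∷ʳ x) k * progressionWords (j ∸ k)))
        ≡⟨ ∑-cong (upTo (suc j)) (λ {k} _ → trans
             (∑-distribʳ-* (rest ys) (λ x → firstPeriodic (ys ∷ʳ x) k) (progressionWords (j ∸ k)))
             (cong (_* progressionWords (j ∸ k)) (sym (firstPeriodic-suc-no ys k ¬per)))) ⟩
      0 + ∑ (upTo (suc j)) (λ k → firstPeriodic ys (suc k) * progressionWords (j ∸ k))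
        ≡⟨ cong (λ a → a * progressionWords (suc j)
             + ∑ (upTo (suc j)) (λ k → firstPeriodic ys (suc k) * progressionWords (j ∸ k)))
             (𝟙-no (periodic? (left ys)) ¬per) ⟨
      firstPeriodic ys 0 * progressionWords (suc j)
        + ∑ (upTo (suc j)) (λ k → firstPeriodic ys (suc k) * progressionWords (j ∸ k))  ∎

-- From the sets `𝒟` to the recursive count

-- Unlike `𝒟`, this includes the prefix of length `j = 0`: for a nonempty word, `left ys` itself
-- must not be periodic.
FirstPeriodic : List (Fin n) → ∀ {k} → Vec (Fin n) k → Set
FirstPeriodic ys {k} u = Unique (ys ++ toList u) × Periodic (left (ys ++ toList u)) ×
  (∀ {j} → j < k → ¬ Periodic (left (ys ++ take j (toList u))))

firstPeriodic-[] : {ys : List (Fin n)} → Unique ys → FirstPeriodic ys [] ⇔ Periodic (left ys)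
firstPeriodic-[] {n} {ys} ys! = mk⇔
  (subst (Periodic ∘ left) (++-identityʳ ys) ∘ proj₁ ∘ proj₂)
  (λ per → subst Unique (sym (++-identityʳ ys)) ys! ,
           subst (Periodic ∘ left) (sym (++-identityʳ ys)) per , λ ())

-- Prefixes shift by one letter, and the empty prefix of `x ∷ u` is covered by the assumption on
-- `left ys`.
firstPeriodic-∷ : {ys : List (Fin n)} {x : Fin n} {k : ℕ} {u : Vec (Fin n) k} →
  ¬ Periodic (left ys) → FirstPeriodic ys (x ∷ u) ⇔ FirstPeriodic (ys ∷ʳ x) u
firstPeriodic-∷ {n} {ys} {x} {k} {u} ¬per = mk⇔
  (λ (unique , per , ¬pers) →
    subst Unique (sym (shift _)) unique , subst (Periodic ∘ left) (sym (shift _)) per ,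
    λ j<k → ¬pers (s<s j<k) ∘ subst (Periodic ∘ left) (shift _))
  (λ (unique , per , ¬pers) →
    subst Unique (shift _) unique , subst (Periodic ∘ left) (shift _) per ,
    λ { {zero}  _         → ¬per ∘ subst (Periodic ∘ left) (++-identityʳ ys)
      ; {suc j} (s<s j<k) → ¬pers j<k ∘ subst (Periodic ∘ left) (sym (shift _)) })
  where
  shift : ∀ vs → ys ∷ʳ x ++ vs ≡ ys ++ x ∷ vs
  shift = ∷ʳ-++ ys x

-- The predicate `Q` is left general so that the induction can pass to `Q? ∘ (x ∷_)`, and so that
-- `𝒟?` after a fixed first letter can be inserted at the end.
length-firstPeriodic : {ys : List (Fin n)} → Unique ys → ∀ k {Q : Vec (Fin n) k → Set}
  (Q? : Decidable Q) → (∀ u → Q u ⇔ FirstPeriodic ys u) →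
  length (filter Q? (words k n)) ≡ firstPeriodic ys k
length-firstPeriodic {n} {ys} ys! zero Q? Q⇔ = begin
  length (filter Q? ([] ∷ []))  ≡⟨ length-filter≡∑ Q? ([] ∷ []) ⟩
  𝟙 (Q? []) + 0                 ≡⟨ ℕ.+-identityʳ _ ⟩
  𝟙 (Q? [])                     ≡⟨ 𝟙-cong (Q? []) (periodic? (left ys))
                                     (firstPeriodic-[] ys! ⇔-∘ Q⇔ []) ⟩
  firstPeriodic ys 0            ∎
  where open ≡-Reasoning
length-firstPeriodic {n} {ys} ys! (suc k) Q? Q⇔ =
  trans (length-filter-cartesianProductWith Q? _∷_ (allFin n) (words k n))
        (lemma (periodic? (left ys)))
  where
  open ≡-Reasoning
  startingWith : Fin n → ℕ
  startingWith x = length (filter (Q? ∘ (x ∷_)) (words k n))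
  startingWith≡0 : ∀ {x} → (∀ u → ¬ FirstPeriodic ys (x ∷ u)) → startingWith x ≡ 0
  startingWith≡0 {x} none = cong length (filter-none (Q? ∘ (x ∷_))
    (All.universal (λ u → none u ∘ to (Q⇔ (x ∷ u))) (words k n)))
  repeated : ∀ {x} → ¬ (x ∉ ys) → startingWith x ≡ 0
  repeated {x} ¬x∉ys = startingWith≡0 λ u (unique , _) →
    ¬x∉ys λ x∈ys → Unique-++⇒Disjoint ys unique (x∈ys , here refl)
    where
    Unique-++⇒Disjoint : ∀ xs {zs : List (Fin n)} → Unique (xs ++ zs) → Disjoint xs zs
    Unique-++⇒Disjoint (x ∷ xs) (x∉ ∷ _) (here refl , v∈zs) = All.lookup x∉ (∈-++⁺ʳ xs v∈zs) refl
    Unique-++⇒Disjoint (x ∷ xs) (_ ∷ u) (there v∈xs , v∈zs) = Unique-++⇒Disjoint xs u (v∈xs , v∈zs)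
  lemma : Dec (Periodic (left ys)) → ∑ (allFin n) startingWith ≡ firstPeriodic ys (suc k)
  lemma (yes per) = trans
    (∑-zero (allFin n) (λ _ → startingWith≡0 λ u (_ , _ , ¬pers) →
      ¬pers z<s (subst (Periodic ∘ left) (sym (++-identityʳ ys)) per)))
    (sym (firstPeriodic-suc-yes ys k per))
  lemma (no ¬per) = begin
    ∑ (allFin n) startingWith
      -- Words starting with a letter of `ys` repeat that letter and contribute nothing.
      ≡⟨ ∑-restrict (λ x → ¬? (x ∈Fin? ys)) (allFin n) repeated ⟨
    ∑ (rest ys) startingWith
      ≡⟨ ∑-cong (rest ys) (λ {x} x∈ → length-firstPeriodic (unique-∷ʳ ys! (to (∈rest⇔∉ ys) x∈)) k
           (Q? ∘ (x ∷_)) (λ u → firstPeriodic-∷ ¬per ⇔-∘ Q⇔ (x ∷ u))) ⟩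
    ∑ (rest ys) (λ x → firstPeriodic (ys ∷ʳ x) k)
      ≡⟨ firstPeriodic-suc-no ys k ¬per ⟨
    firstPeriodic ys (suc k)  ∎

-- The prefixes of `x ∷ u` tested by `𝒟` have length at least 1, so they are `x` followed by the
-- prefixes of `u`, including the empty one.
𝒟⇔FirstPeriodic : {x : Fin n} {k : ℕ} (u : Vec (Fin n) k) → 𝒟 (x ∷ u) ⇔ FirstPeriodic (x ∷ []) u
𝒟⇔FirstPeriodic {n} {x} {k} u = mk⇔
  (λ (unique , per , ¬pers) → unique , subst (Periodic ∘ left ∘ (x ∷_)) take≡ per ,
    λ j<k → ¬pers (s<s j<k) (s≤s z≤n))
  (λ (unique , per , ¬pers) → unique , subst (Periodic ∘ left ∘ (x ∷_)) (sym take≡) per ,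
    λ { {suc j} (s<s j<k) _ → ¬pers j<k })
  where
  take≡ : take k (toList u) ≡ toList u
  take≡ = take-all k (toList u) (ℕ.≤-reflexive (length-toList u))

d-suc : ∀ k n → d (suc k) n ≡ ∑ (allFin n) λ x → firstPeriodic (x ∷ []) k
d-suc k n = trans (length-filter-cartesianProductWith 𝒟? _∷_ (allFin n) (words k n))
  (∑-cong (allFin n) λ {x} _ →
    length-firstPeriodic ([] ∷ []) k (𝒟? ∘ (x ∷_)) 𝒟⇔FirstPeriodic)

allLeft-periodic : 2 ≤ n → Periodic (left {n} [])
allLeft-periodic {n} 2≤n = progression-periodic (left []) 0 0 2≤n bounded
  λ x → mk⇔
    (λ _ → subst (_∈ progression 0 0 n) (ℕ.*-identityʳ (toℕ x)) (∈-progression⁺ 0 0 (Fin.toℕ<n x)))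
    (λ _ → from (∈left⇔∉ []) λ ())
  where
  bounded : ∀ {v} → v ∈ progression 0 0 n → v < n
  bounded v∈ with ∈-progression⁻ 0 0 v∈
  ... | t , t<n , refl = subst (_< n) (sym (ℕ.*-identityʳ t)) t<n

-- The identity in natural numbers

module _ (m : ℕ) .{{_ : NonZero m}} where

  -- The decomposition is applied after each choice of first letter `x`: starting from the empty
  -- list it would always cut at once, as the whole alphabet is periodic. Summed over `x`, the
  -- counts give `endPeriodic [] (suc j)`, which is known for the same reason.
  ∑-d*progressionWords : ∀ j → n ≡ suc j + suc m →
    ∑ (upTo (suc j)) (λ k → d (suc k) n * progressionWords m (j ∸ k)) ≡ progressionWords m (suc j)
  ∑-d*progressionWords {n} j n≡ = begin
    ∑ (upTo (suc j)) (λ k → d (suc k) n * progressionWords m (j ∸ k))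
      ≡⟨ ∑-cong (upTo (suc j)) (λ {k} _ → trans
           (cong (_* progressionWords m (j ∸ k)) (d-suc k n))
           (sym (∑-distribʳ-* (allFin n) (λ x → firstPeriodic (x ∷ []) k) _))) ⟩
    ∑ (upTo (suc j)) (λ k → ∑ (allFin n) (λ x → firstPeriodic (x ∷ []) k * progressionWords m (j ∸ k)))
      ≡⟨ ∑-comm (upTo (suc j)) (allFin n) _ ⟩
    ∑ (allFin n) (λ x → ∑ (upTo (suc j)) (λ k → firstPeriodic (x ∷ []) k * progressionWords m (j ∸ k)))
      ≡⟨ ∑-cong (allFin n) (λ {x} _ → endPeriodic-decompose m ([] ∷ []) j (sym n≡)) ⟨
    ∑ (allFin n) (λ x → endPeriodic (x ∷ []) j)
      ≡⟨ ∑-restrict (λ x → ¬? (x ∈Fin? [])) (allFin n) (λ ¬x∉[] → contradiction (λ ()) ¬x∉[]) ⟨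
    endPeriodic {n} [] (suc j)
      ≡⟨ endPeriodic-periodic m [] (suc j) (sym n≡)
           (allLeft-periodic (subst (2 ≤_) (sym n≡) (2≤j+1+m m (suc j)))) ⟩
    progressionWords m (suc j)  ∎
    where open ≡-Reasoning

  -- For `l = e + m + 1` the factor l + r - m becomes r + e + 1, the form it has in the theorem.
  2*length-progressions≡ : ∀ e {l} → l ≡ e + suc m →
    2 * length (progressions m l) ≡ l / m * (l % m + e + 1)
  2*length-progressions≡ e {l} l≡ = ℕ.+-cancelʳ-≡ (m * q) _ _ (begin
    2 * length (progressions m l) + m * q  ≡⟨ 2*length-progressions m l (m≡m%n+[m/n]*n l m) (m%n<n l m) ⟩
    q * (l + r)                            ≡⟨ cong (λ k → q * (k + r)) l≡ ⟩
    q * (e + suc m + r)                    ≡⟨ regroup q e m r ⟩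
    q * (r + e + 1) + m * q                ∎)
    where
    open ≡-Reasoning
    q = l / m
    r = l % m
    regroup : ∀ q e m r → q * (e + suc m + r) ≡ q * (r + e + 1) + m * q
    regroup = solve-∀

-- Passage to the rationals

-- Fractions are `fromℚᵘ` of unnormalised ones, so products can be computed before reducing to
-- lowest terms.
fromℚᵘ-* : ∀ p q → ℚ.fromℚᵘ p ℚ.* ℚ.fromℚᵘ q ≡ ℚ.fromℚᵘ (p ℚᵘ.* q)
fromℚᵘ-* p q = ℚ.toℚᵘ-injective (ℚᵘ.≃-trans (ℚ.toℚᵘ-homo-* (ℚ.fromℚᵘ p) (ℚ.fromℚᵘ q))
  (ℚᵘ.≃-trans (ℚᵘ.*-cong (ℚ.toℚᵘ-fromℚᵘ p) (ℚ.toℚᵘ-fromℚᵘ q)) (ℚᵘ.≃-sym (ℚ.toℚᵘ-fromℚᵘ (p ℚᵘ.* q)))))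

fromℚᵘ-+ : ∀ p q → ℚ.fromℚᵘ p ℚ.+ ℚ.fromℚᵘ q ≡ ℚ.fromℚᵘ (p ℚᵘ.+ q)
fromℚᵘ-+ p q = ℚ.toℚᵘ-injective (ℚᵘ.≃-trans (ℚ.toℚᵘ-homo-+ (ℚ.fromℚᵘ p) (ℚ.fromℚᵘ q))
  (ℚᵘ.≃-trans (ℚᵘ.+-cong (ℚ.toℚᵘ-fromℚᵘ p) (ℚ.toℚᵘ-fromℚᵘ q)) (ℚᵘ.≃-sym (ℚ.toℚᵘ-fromℚᵘ (p ℚᵘ.+ q)))))

fromℕ-+ : ∀ a b → fromℕ (a + b) ≡ fromℕ a ℚ.+ fromℕ b
fromℕ-+ a b = sym (trans (fromℚᵘ-+ (mkℚᵘ (ℤ.+ a) 0) (mkℚᵘ (ℤ.+ b) 0))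
  (cong (ℚ._/ 1) (cong₂ ℤ._+_ (ℤ.*-identityʳ (ℤ.+ a)) (ℤ.*-identityʳ (ℤ.+ b)))))

fromℕ-* : ∀ a b → fromℕ (a * b) ≡ fromℕ a ℚ.* fromℕ b
fromℕ-* a b = sym (trans (fromℚᵘ-* (mkℚᵘ (ℤ.+ a) 0) (mkℚᵘ (ℤ.+ b) 0))
  (cong (ℚ._/ 1) (sym (ℤ.pos-* a b))))

-- After cross-multiplication the claim is the hypothesis, an equation between natural numbers.
half-* : ∀ q b c → 2 * c ≡ q * b → ℤ.+ q ℚ./ 2 ℚ.* fromℕ b ≡ fromℕ c
half-* q b c 2c≡qb = trans (fromℚᵘ-* (mkℚᵘ (ℤ.+ q) 1) (mkℚᵘ (ℤ.+ b) 0))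
  (ℚ.fromℚᵘ-cong {mkℚᵘ (ℤ.+ q ℤ.* ℤ.+ b) 1} {mkℚᵘ (ℤ.+ c) 0} (*≡* (begin
    ℤ.+ q ℤ.* ℤ.+ b ℤ.* ℤ.+ 1  ≡⟨ ℤ.*-identityʳ _ ⟩
    ℤ.+ q ℤ.* ℤ.+ b            ≡⟨ ℤ.pos-* q b ⟨
    ℤ.+ (q * b)                ≡⟨ cong ℤ.+_ (trans (sym 2c≡qb) (ℕ.*-comm 2 c)) ⟩
    ℤ.+ (c * 2)                ≡⟨ ℤ.pos-* c 2 ⟩
    ℤ.+ c ℤ.* ℤ.+ 2            ∎)))
  where open ≡-Reasoning

fromℕ-∑ : ∀ i (f : ℕ → ℕ) {g : Fin i → ℚ} → (∀ x → g x ≡ fromℕ (f (toℕ x))) →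
  ∑[ x < i ] g x ≡ fromℕ (∑ (upTo i) f)
fromℕ-∑ zero    f g≡ = refl
fromℕ-∑ (suc i) f {g} g≡ = trans (cong₂ ℚ._+_ (g≡ Fin.zero) (fromℕ-∑ i (f ∘ suc) (g≡ ∘ Fin.suc)))
  (sym (trans (cong fromℕ (∑-upTo-suc i f)) (fromℕ-+ (f 0) _)))

module _ (m : ℕ) .{{_ : NonZero m}} where

  -- The second factor `b` is a separate argument because the two sides of the theorem write r + e +
  -- 1 differently.
  fromℕ-progressionWords : ∀ e {l} → l ≡ e + suc m → ∀ b → b ≡ l % m + e + 1 →
    ℤ.+ (l / m) ℚ./ 2 ℚ.* fromℕ b ≡ fromℕ (length (progressions m (e + suc m)))
  fromℕ-progressionWords e refl b refl = half-* ((e + suc m) / m) b (length (progressions m (e + suc m)))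
    (2*length-progressions≡ m e refl)

  ∑-d : ∀ i → 1 ≤ i → n ≡ i + suc m →
    ∑[ j < i ] (let k = suc (toℕ j) in
      ℤ.+ ((n ∸ k) / m) ℚ./ 2
        ℚ.* fromℕ ((n ∸ k) % m + i ∸ k + 1)
        ℚ.* fromℕ (d k n)
        ℚ.* fromℕ ((i ∸ k) !))
    ≡ ℤ.+ (n / m) ℚ./ 2 ℚ.* fromℕ (n % m + i + 1) ℚ.* fromℕ (i !)
  ∑-d {n} (suc j) _ n≡ = begin
    ∑[ x < suc j ] summand x
      ≡⟨ fromℕ-∑ (suc j) (λ k → d (suc k) n * progressionWords m (j ∸ k)) {summand} term ⟩
    fromℕ (∑ (upTo (suc j)) (λ k → d (suc k) n * progressionWords m (j ∸ k)))
      ≡⟨ cong fromℕ (∑-d*progressionWords m j n≡) ⟩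
    fromℕ (progressionWords m (suc j))
      ≡⟨ fromℕ-* (length (progressions m (suc j + suc m))) (suc j !) ⟩
    fromℕ (length (progressions m (suc j + suc m))) ℚ.* fromℕ (suc j !)
      ≡⟨ cong (ℚ._* fromℕ (suc j !)) (fromℕ-progressionWords (suc j) n≡ _ refl) ⟨
    ℤ.+ (n / m) ℚ./ 2 ℚ.* fromℕ (n % m + suc j + 1) ℚ.* fromℕ (suc j !) ∎
    where
    open ≡-Reasoning
    summand : Fin (suc j) → ℚ
    summand x = let k = suc (toℕ x) in
      ℤ.+ ((n ∸ k) / m) ℚ./ 2 ℚ.* fromℕ ((n ∸ k) % m + suc j ∸ k + 1)
        ℚ.* fromℕ (d k n) ℚ.* fromℕ ((suc j ∸ k) !)
    term : ∀ x → summand x ≡ fromℕ (d (suc (toℕ x)) n * progressionWords m (j ∸ toℕ x))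
    term x = begin
      ℤ.+ ((n ∸ k) / m) ℚ./ 2 ℚ.* fromℕ ((n ∸ k) % m + suc j ∸ k + 1) ℚ.* fromℕ (d k n) ℚ.* fromℕ (e !)
        -- Here `e` is `suc j ∸ k`. In the summand `k` is subtracted from the whole sum
        -- `(n ∸ k) % m + suc j`; as `k ≤ suc j`, the subtraction moves onto `suc j`.
        ≡⟨ cong (λ p → p ℚ.* fromℕ (d k n) ℚ.* fromℕ (e !)) (fromℕ-progressionWords e
             (trans (cong (_∸ k) n≡) (ℕ.+-∸-comm (suc m) k≤i)) _
             (cong (_+ 1) (ℕ.+-∸-assoc ((n ∸ k) % m) k≤i))) ⟩
      fromℕ c ℚ.* fromℕ (d k n) ℚ.* fromℕ (e !)
        ≡⟨ cong (ℚ._* fromℕ (e !)) (ℚ.*-comm (fromℕ c) (fromℕ (d k n))) ⟩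
      fromℕ (d k n) ℚ.* fromℕ c ℚ.* fromℕ (e !)
        ≡⟨ ℚ.*-assoc (fromℕ (d k n)) (fromℕ c) (fromℕ (e !)) ⟩
      fromℕ (d k n) ℚ.* (fromℕ c ℚ.* fromℕ (e !))
        ≡⟨ cong (fromℕ (d k n) ℚ.*_) (fromℕ-* c (e !)) ⟨
      fromℕ (d k n) ℚ.* fromℕ (c * e !)
        ≡⟨ fromℕ-* (d k n) (c * e !) ⟨
      fromℕ (d k n * (c * e !)) ∎
      where
      k = suc (toℕ x)
      e = j ∸ toℕ x
      c = length (progressions m (e + suc m))
      k≤i : k ≤ suc j
      k≤i = Fin.toℕ<n x

mainTheorem10 :
    ∀ (n i : ℕ) (4≤n : 4 ≤ n) (1≤i : 1 ≤ i) (i≤n-2 : i ≤ n ∸ 2) →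
    let m = n ∸ i ∸ 1
        instance
          m≢0 : NonZero m
          m≢0 = m-nonZero 4≤n i≤n-2
    in
    ∑[ j < i ] (let k = suc (toℕ j) in
      ℤ.+ ((n ∸ k) ℕ./ m) ℚ./ 2
        ℚ.* fromℕ ((n ∸ k) ℕ.% m ℕ.+ i ∸ k ℕ.+ 1)
        ℚ.* fromℕ (d k n)
        ℚ.* fromℕ ((i ∸ k) !))
    ≡ ℤ.+ (n ℕ./ m) ℚ./ 2 ℚ.* fromℕ (n ℕ.% m ℕ.+ i ℕ.+ 1) ℚ.* fromℕ (i !)
mainTheorem10 n i 4≤n 1≤i i≤n-2 =
  -- Since `i < n`, the truncated subtractions in `m` are exact and n = i + (m + 1).
  ∑-d (n ∸ i ∸ 1) {{m-nonZero 4≤n i≤n-2}} {n} i 1≤i (sym (begin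
    i + (1 + (n ∸ i ∸ 1))  ≡⟨ cong (i +_) (ℕ.m+[n∸m]≡n (ℕ.m<n⇒0<n∸m i<n)) ⟩
    i + (n ∸ i)            ≡⟨ ℕ.m+[n∸m]≡n (ℕ.<⇒≤ i<n) ⟩
    n                      ∎))
  where
  open ≡-Reasoning
  i<n : i < n
  i<n = ℕ.≤-<-trans i≤n-2 (ℕ.∸-monoʳ-< {n} {2} {0} z<s (ℕ.≤-trans (s≤s (s≤s z≤n)) 4≤n))
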